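{- Let $H$ be a digraph (possibly with loops) and let $D$ be an $H$-colored quasi-transitive digraph. If $k \geq 4$, then $D$ has a $(k,H)$-kernel.
   Context: All digraphs are finite. A digraph $D$ is quasi-transitive if for all distinct $u,v\in V(D)$, whenever there is a directed $uv$-path of length $2$, $u$ and $v$ are joined by an arc (in some direction). $D$ has no loops and comes with a map $\rho: A(D)\to V(H)$. For a walk $W=(x_0,\ldots,x_n)$ in $D$, there is an obstruction on $x_i$ if $(\rho(x_{i-1},x_i),\rho(x_i,x_{i+1})) \notin A(H)$; for an open walk this is considered at internal vertices $x_i$, $1\le i\le n-1$, for a closed walk at all $i\in\{0,\ldots,n-1\}$ with indices modulo $n$. $O_H(W)$ is the set of indices with an obstruction; the $H$-length is $l_H(W)=|O_H(W)|+1$ for open $W$ and $|O_H(W)|$ for closed $W$. A $(k,H)$-kernel ($k\ge2$) is a set $S\subseteq V(D)$ such that for every two distinct $u,v\in S$ every directed $uv$-path in $D$ has $H$-length at least $k$, and for every $x\in V(D)\setminus S$ there is a directed path from $x$ to a vertex of $S$ of $H$-length at most $k-1$. -}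

module Defs where

open import Data.Fin using (Fin)
open import Data.Fin.Subset using (Subset; _∈_; _∉_; ∣_∣)
open import Data.List using (List; []; _∷_)
open import Data.List.Relation.Unary.Unique.Propositional using (Unique)
open import Data.Nat using (ℕ; suc; pred; _+_; _≤_; _∸_)
open import Data.Product using (Σ-syntax; _×_)
open import Data.Sum using (_⊎_)
import Data.Vec as Vec
open import Level using (0ℓ)
open import Relation.Binary.Core using (Rel)
open import Relation.Binary.Definitions using (Decidable; Irrelevant)
open import Relation.Binary.Construct.Closure.ReflexiveTransitive using (Star; ε; _◅_)
open import Relation.Binary.PropositionalEquality using (_≡_; _≢_)
open import Relation.Nullary using (¬_; does; ¬?)

-- Loops and pairs of opposite arcs are allowed; irrelevance excludes
-- parallel arcs, so a map out of the arcs depends only on the end points.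
record Digraph : Set₁ where
  field
    order          : ℕ
    Arc            : Rel (Fin order) 0ℓ
    arc?           : Decidable Arc
    arc-irrelevant : Irrelevant Arc

  Vertex : Set
  Vertex = Fin order

open Digraph public using (Vertex)

module _ (D : Digraph) where
  open Digraph D using (Arc)

  Loopless : Set
  Loopless = (u : Vertex D) → ¬ Arc u u

  Walk : Rel (Vertex D) 0ℓ
  Walk = Star Arc

module _ {D : Digraph} where

  length : {u v : Vertex D} → Walk D u v → ℕ
  length ε       = 0
  length (_ ◅ w) = suc (length w)

  vertices : {u v : Vertex D} → Walk D u v → List (Vertex D)
  vertices {u} ε       = u ∷ []
  vertices {u} (_ ◅ w) = u ∷ vertices w

  IsPath : {u v : Vertex D} → Walk D u v → Set
  IsPath w = Unique (vertices w)

QuasiTransitive : Digraph → Set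
QuasiTransitive D = {u v : Vertex D} → u ≢ v →
  Σ[ w ∈ Walk D u v ] (IsPath {D} w × length {D} w ≡ 2) →
  Arc u v ⊎ Arc v u
  where open Digraph D using (Arc)

Coloring : Digraph → Digraph → Set
Coloring D H = {u v : Vertex D} → Digraph.Arc D u v → Vertex H

module _ (H D : Digraph) (ρ : Coloring D H) where

  -- Index i of the subset stands for the internal vertex x_{i+1} of the
  -- walk (x_0 , … , x_n), so the n ∸ 1 indices are those of an open walk.
  obstructions : {u v : Vertex D} (w : Walk D u v) → Subset (pred (length {D} w))
  obstructions ε             = Vec.[]
  obstructions (_ ◅ ε)       = Vec.[]
  obstructions (a ◅ (b ◅ w)) =
    does (¬? (Digraph.arc? H (ρ a) (ρ b))) Vec.∷ obstructions (b ◅ w)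

  -- The H-length of an open walk. Closed walks, which have a different
  -- H-length, do not arise below: a path between distinct vertices is open.
  hLength : {u v : Vertex D} → Walk D u v → ℕ
  hLength w = ∣ obstructions w ∣ + 1

  record IsKernel (k : ℕ) (S : Subset (Digraph.order D)) : Set where
    field
      independent : {u v : Vertex D} → u ∈ S → v ∈ S → u ≢ v →
                    (w : Walk D u v) → IsPath {D} w → k ≤ hLength w
      absorbent   : {x : Vertex D} → x ∉ S →
                    Σ[ s ∈ Vertex D ] (s ∈ S ×
                      Σ[ w ∈ Walk D x s ] (IsPath {D} w × hLength w ≤ k ∸ 1))

{-# OPTIONS --safe #-}
module Submission where

-- Only reachability and ordinary path lengths matter: a path of length at most
-- 3 has H-length at most 3 ≤ k ∸ 1, and vertices that do not reach each other
-- are trivially far apart. In a quasi-transitive digraph, if x reaches y then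
-- there is a walk of length at most 3 from x to y, or the arc y → x. Let S have
-- one vertex of maximum in-degree from each terminal strong component. If x
-- reaches s ∈ S but no walk of length at most 3 does, then s → x, and every
-- in-neighbour y of s satisfies y → s → x, hence y → x (as x → y would give
-- x → y → s). So x lies in the component of s and has larger in-degree.

open import Defs
open import Data.Bool using (true)
open import Data.Nat using (ℕ; zero; suc; pred; _+_; _∸_; _≤_; _<_; z≤n; s≤s)
open import Data.Nat.Properties
  using (≤-refl; ≤-trans; +-mono-≤; +-monoˡ-≤; pred-mono-≤; ∸-monoˡ-≤; m≤n⇒m≤1+n;
         n≤1+n; <-isStrictTotalOrder)
open import Data.Fin as Fin using (Fin; zero; suc)
open import Data.Fin.Induction using (spo-noetherian)
import Data.Fin.Properties as Fin
open import Data.Fin.Subset using (Subset; _∈_; ∣_∣)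
open import Data.Fin.Subset.Properties using (∣p∣≤n; p⊂q⇒∣p∣<∣q∣)
open import Data.List as List using (List; []; _∷_)
open import Data.List.Membership.Propositional renaming (_∈_ to _∈ₗ_) using ()
open import Data.List.Membership.Propositional.Properties using (∈-lookup)
import Data.List.Membership.DecPropositional as DecMembership
open import Data.List.Relation.Unary.All as All using ([]; _∷_)
open import Data.List.Relation.Unary.All.Properties using (¬Any⇒All¬)
open import Data.List.Relation.Unary.AllPairs using ([]; _∷_)
open import Data.List.Relation.Unary.Any using (here; there)
open import Data.List.Relation.Unary.Unique.Propositional using (Unique)
open import Data.Product using (Σ-syntax; ∃; _×_; _,_; proj₁; proj₂)
open import Data.Product.Relation.Binary.Lex.Strict using (×-Lex; ×-isStrictTotalOrder)
open import Data.Sum using (_⊎_; inj₁; inj₂; [_,_]′)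
open import Data.Vec using (tabulate)
open import Data.Vec.Properties using (lookup∘tabulate; lookup⇒[]=; []=⇒lookup)
open import Function using (_∘_)
open import Induction.WellFounded using (Acc; acc)
open import Level using (0ℓ)
open import Relation.Binary.Core using (Rel)
open import Relation.Binary.Definitions
  using (Decidable; Reflexive; Transitive; tri<; tri≈; tri>)
open import Relation.Binary.Structures using (IsStrictPartialOrder; IsStrictTotalOrder)
open import Relation.Binary.Construct.Closure.ReflexiveTransitive using (ε; _◅_; _◅◅_)
open import Relation.Binary.PropositionalEquality
  using (_≡_; _≢_; refl; sym; trans; cong; subst; isEquivalence; resp₂)
open import Relation.Nullary using (¬_; Dec; yes; no; does; ¬?; contradiction)
open import Relation.Nullary.Decidable using (map′; _×-dec_; _⊎-dec_; decidable-stable; dec-true)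
import Relation.Unary as Unary

-- Repetition-free lists and decidable subsets.

-- Turns a repetition-free list into an injection, which bounds its length by the number of
-- vertices.
lookup-injective : {A : Set} {xs : List A} → Unique xs →
                   {i j : Fin (List.length xs)} → List.lookup xs i ≡ List.lookup xs j → i ≡ j
lookup-injective (_ ∷ _)   {zero}  {zero}  _  = refl
lookup-injective (x∉ ∷ _)  {zero}  {suc j} eq = contradiction eq (All.lookup x∉ (∈-lookup j))
lookup-injective (x∉ ∷ _)  {suc i} {zero}  eq = contradiction (sym eq) (All.lookup x∉ (∈-lookup i))
lookup-injective (_ ∷ xs!) {suc i} {suc j} eq = cong suc (lookup-injective xs! eq)

module _ {n : ℕ} {P : Unary.Pred (Fin n) 0ℓ} (P? : Unary.Decidable P) where

  comprehension : Subset n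
  comprehension = tabulate (does ∘ P?)

  ∈-comprehension⁺ : ∀ {x} → P x → x ∈ comprehension
  ∈-comprehension⁺ {x} px =
    lookup⇒[]= x _ (trans (lookup∘tabulate (does ∘ P?) x) (dec-true (P? x) px))

  ∈-comprehension⁻ : ∀ {x} → x ∈ comprehension → P x
  ∈-comprehension⁻ {x} x∈ = witness (P? x) (trans (sym (lookup∘tabulate (does ∘ P?) x)) ([]=⇒lookup x∈))
    where
    witness : (p : Dec (P x)) → does p ≡ true → P x
    witness (yes px) _ = px

-- Maximal elements of a finite preorder.

-- A key breaks the ties between vertices of the same class of the preorder.
module Representatives {n : ℕ} {_⇒_ : Rel (Fin n) 0ℓ}
  (⇒-refl : Reflexive _⇒_) (⇒-trans : Transitive _⇒_) (_⇒?_ : Decidable _⇒_)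
  (weight : Fin n → ℕ) where

  Key : Set
  Key = ℕ × Fin n

  key : Fin n → Key
  key x = weight x , x

  _<ₖ_ : Rel Key 0ℓ
  _<ₖ_ = ×-Lex _≡_ _<_ Fin._<_

  module Lex = IsStrictTotalOrder
    (×-isStrictTotalOrder <-isStrictTotalOrder (Fin.<-isStrictTotalOrder {n}))

  -- The first alternative leaves the class of `x` for good; the second moves to a larger key. A
  -- maximal element thus lies in a terminal class and has the largest key there.
  _≺_ : Rel (Fin n) 0ℓ
  x ≺ y = x ⇒ y × (¬ (y ⇒ x) ⊎ key x <ₖ key y)

  _≺?_ : Decidable _≺_
  x ≺? y = (x ⇒? y) ×-dec (¬? (y ⇒? x) ⊎-dec (key x Lex.<? key y))

  ≺-trans : Transitive _≺_
  ≺-trans (x⇒y , p) (y⇒z , q) = ⇒-trans x⇒y y⇒z , strict p q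
    where
    strict : _ → _ → _
    strict (inj₁ y⇏x) _           = inj₁ λ z⇒x → y⇏x (⇒-trans y⇒z z⇒x)
    strict (inj₂ _)   (inj₁ z⇏y)  = inj₁ λ z⇒x → z⇏y (⇒-trans z⇒x x⇒y)
    strict (inj₂ x<y) (inj₂ y<z)  = inj₂ (Lex.trans x<y y<z)

  ≺-isStrictPartialOrder : IsStrictPartialOrder _≡_ _≺_
  ≺-isStrictPartialOrder = record
    { isEquivalence = isEquivalence
    ; irrefl        = λ { refl (_ , inj₁ x⇏x) → x⇏x ⇒-refl
                        ; refl (_ , inj₂ x<x) → Lex.irrefl (refl , refl) x<x }
    ; trans         = ≺-trans
    ; <-resp-≈      = resp₂ _≺_
    }

  Maximal : Fin n → Set
  Maximal x = ¬ ∃ (x ≺_)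

  maximal? : Unary.Decidable Maximal
  maximal? x = ¬? (Fin.any? (x ≺?_))

  maximal-above : ∀ x → ∃ λ y → x ⇒ y × Maximal y
  maximal-above x = go (spo-noetherian ≺-isStrictPartialOrder x)
    where
    go : ∀ {x} → Acc (λ y z → z ≺ y) x → ∃ λ y → x ⇒ y × Maximal y
    go {x} (acc rec) with Fin.any? (x ≺?_)
    ... | no  max       = x , ⇒-refl , max
    ... | yes (y , x≺y) =
      let z , y⇒z , max = go (rec x≺y) in z , ⇒-trans (proj₁ x≺y) y⇒z , max

  -- If `y` did not reach back, it would lie strictly above `x`. Otherwise both share a class, where
  -- distinct vertices have distinct keys and the smaller one is not maximal.
  maximal-unique : ∀ {x y} → Maximal x → Maximal y → x ⇒ y → x ≡ y
  maximal-unique {x} {y} max-x max-y x⇒y with y ⇒? x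
  ... | no  y⇏x = contradiction (y , x⇒y , inj₁ y⇏x) max-x
  ... | yes y⇒x with Lex.compare (key x) (key y)
  ...   | tri< x<y _ _ = contradiction (y , x⇒y , inj₂ x<y) max-x
  ...   | tri≈ _ x≡y _ = proj₂ x≡y
  ...   | tri> _ _ y<x = contradiction (x , y⇒x , inj₂ y<x) max-y

  maximal-heaviest : ∀ {x y} → Maximal x → x ⇒ y → ¬ (weight x < weight y)
  maximal-heaviest {y = y} max x⇒y x<y = max (y , x⇒y , inj₂ (inj₁ x<y))

-- Bounded distance and decidable reachability.

module Reachability (D : Digraph) where
  open Digraph D using (Arc; arc?; order)

  WithinDistance : ℕ → Rel (Vertex D) 0ℓ
  WithinDistance m x y = Σ[ w ∈ Walk D x y ] length {D} w ≤ m

  length-◅◅ : ∀ {x y z} (v : Walk D x y) (w : Walk D y z) →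
              length {D} (v ◅◅ w) ≡ length {D} v + length {D} w
  length-◅◅ ε       w = refl
  length-◅◅ (_ ◅ v) w = cong suc (length-◅◅ v w)

  within-refl : ∀ {x} → WithinDistance 0 x x
  within-refl = ε , z≤n

  within-arc : ∀ {x y} → Arc x y → WithinDistance 1 x y
  within-arc a = a ◅ ε , s≤s z≤n

  within-trans : ∀ {l m x y z} →
                 WithinDistance l x y → WithinDistance m y z → WithinDistance (l + m) x z
  within-trans (v , v≤l) (w , w≤m) =
    v ◅◅ w , subst (_≤ _) (sym (length-◅◅ v w)) (+-mono-≤ v≤l w≤m)

  within-mono : ∀ {l m x y} → l ≤ m → WithinDistance l x y → WithinDistance m x y
  within-mono l≤m (w , w≤l) = w , ≤-trans w≤l l≤m

  within? : ∀ m → Decidable (WithinDistance m)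
  within? zero x y = map′ (λ { refl → within-refl }) (λ { (ε , _) → refl }) (x Fin.≟ y)
  within? (suc m) x y =
    map′ to from ((x Fin.≟ y) ⊎-dec Fin.any? λ z → arc? x z ×-dec within? m z y)
    where
    Step : Set
    Step = x ≡ y ⊎ ∃ λ z → Arc x z × WithinDistance m z y

    to : Step → WithinDistance (suc m) x y
    to (inj₁ refl)              = ε , z≤n
    to (inj₂ (_ , a , w , w≤m)) = a ◅ w , s≤s w≤m

    from : WithinDistance (suc m) x y → Step
    from (ε     , _)       = inj₁ refl
    from (a ◅ w , s≤s w≤m) = inj₂ (_ , a , w , w≤m)

  suffix-path : ∀ {u v x} (w : Walk D u v) → IsPath {D} w → x ∈ₗ vertices {D} w →
                Σ[ p ∈ Walk D x v ] (IsPath {D} p × length {D} p ≤ length {D} w)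
  suffix-path ε       w!       (here refl) = ε , w! , z≤n
  suffix-path (a ◅ w) w!       (here refl) = a ◅ w , w! , ≤-refl
  suffix-path (_ ◅ w) (_ ∷ w!) (there x∈)  =
    let p , p! , p≤w = suffix-path w w! x∈ in p , p! , m≤n⇒m≤1+n p≤w

  open DecMembership (Fin._≟_ {order}) using () renaming (_∈?_ to _∈ₗ?_)

  -- If the new start `u` already occurs on the path, the path is cut to begin at that occurrence.
  walk⇒path : ∀ {u v} (w : Walk D u v) →
              Σ[ p ∈ Walk D u v ] (IsPath {D} p × length {D} p ≤ length {D} w)
  walk⇒path ε = ε , ([] ∷ []) , z≤n
  walk⇒path {u} (a ◅ w) with walk⇒path w
  ... | p , p! , p≤w with u ∈ₗ? vertices {D} p
  ...   | no  u∉p = a ◅ p , (¬Any⇒All¬ _ u∉p ∷ p!) , s≤s p≤w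
  ...   | yes u∈p =
    let q , q! , q≤p = suffix-path p p! u∈p in q , q! , m≤n⇒m≤1+n (≤-trans q≤p p≤w)

  length-vertices : ∀ {u v} (w : Walk D u v) → List.length (vertices {D} w) ≡ suc (length {D} w)
  length-vertices ε       = refl
  length-vertices (_ ◅ w) = cong suc (length-vertices w)

  path-length≤order : ∀ {u v} (p : Walk D u v) → IsPath {D} p → length {D} p ≤ order
  path-length≤order p p! =
    ≤-trans (n≤1+n _)
      (subst (_≤ order) (length-vertices p) (Fin.injective⇒≤ (lookup-injective p!)))

  -- A search up to distance `order` suffices, because every walk shortens to a path.
  walk? : Decidable (Walk D)
  walk? x y = map′ proj₁ bound (within? order x y)
    where
    bound : Walk D x y → WithinDistance order x y
    bound w = let p , p! , _ = walk⇒path w in p , path-length≤order p p!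

-- Distances and in-degrees in quasi-transitive digraphs.

module QuasiTransitivity (D : Digraph) (loopless : Loopless D) (qt : QuasiTransitive D) where
  open Digraph D using (Arc; arc?; order)
  open Reachability D

  loop-free : ∀ {x y} → Arc x y → x ≢ y
  loop-free a refl = loopless _ a

  comparable : ∀ {u v w} → Arc u v → Arc v w → u ≡ w ⊎ (Arc u w ⊎ Arc w u)
  comparable {u} {v} {w} a b with u Fin.≟ w
  ... | yes u≡w = inj₁ u≡w
  ... | no  u≢w = inj₂ (qt u≢w (a ◅ b ◅ ε , path , refl))
    where
    path : IsPath {D} (a ◅ b ◅ ε)
    path = (loop-free a ∷ u≢w ∷ []) ∷ (loop-free b ∷ []) ∷ [] ∷ []

  Near : Rel (Vertex D) 0ℓ
  Near = WithinDistance 3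

  -- Distance at most 1 also absorbs the case `u ≡ w`, about which quasi-transitivity says nothing.
  shortcut-or-back : ∀ {u v w} → Arc u v → Arc v w → WithinDistance 1 u w ⊎ Arc w u
  shortcut-or-back a b with comparable a b
  ... | inj₁ refl       = inj₁ (within-mono z≤n within-refl)
  ... | inj₂ (inj₁ u→w) = inj₁ (within-arc u→w)
  ... | inj₂ (inj₂ w→u) = inj₂ w→u

  -- An arc from `x` back to `u` would bring `x` within 1 + 2 of `y`. This pulls arcs into `x`
  -- backwards along a walk.
  near-or-forward : ∀ {u v x y} → Arc u v → Arc v x → WithinDistance 2 u y → Near x y ⊎ Arc u x
  near-or-forward a b near with comparable a b
  ... | inj₁ refl       = inj₁ (within-mono (n≤1+n 2) near)
  ... | inj₂ (inj₁ u→x) = inj₂ u→x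
  ... | inj₂ (inj₂ x→u) = inj₁ (within-trans (within-arc x→u) near)

  -- The directed triangle that arises when a walk starting `x → a → b` has no shortcut from `x` to
  -- `b`.
  module _ {x a b y : Vertex D} (x→a : Arc x a) (a→b : Arc a b) (b→x : Arc b x) where

    return : Arc y b → Near x y ⊎ Arc y x
    return y→b = near-or-forward y→b b→x (within-mono z≤n within-refl)

    close-tail₁ : WithinDistance 1 b y → Near x y ⊎ Arc y x
    close-tail₁ near = inj₁ (within-trans (within-arc x→a) (within-trans (within-arc a→b) near))

    close-tail₂ : WithinDistance 2 b y → Near x y ⊎ Arc y x
    close-tail₂ (ε , _)                = close-tail₁ (ε , z≤n)
    close-tail₂ (c ◅ ε , _)            = close-tail₁ (within-arc c)
    close-tail₂ (c ◅ d ◅ ε , _)        = [ close-tail₁ , return ]′ (shortcut-or-back c d)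
    close-tail₂ (_ ◅ _ ◅ _ ◅ _ , s≤s (s≤s ()))

    -- With b → c → d → y, the arcs d → x, c → x and y → x arise in this order,
    -- each from the previous one, unless x comes near y.
    close-tail₃ : Near b y → Near x y ⊎ Arc y x
    close-tail₃ (ε , _)         = close-tail₁ (ε , z≤n)
    close-tail₃ (c ◅ ε , _)     = close-tail₁ (within-arc c)
    close-tail₃ (c ◅ d ◅ ε , _) = close-tail₂ (c ◅ d ◅ ε , ≤-refl)
    close-tail₃ (b→c ◅ c→d ◅ d→y ◅ ε , _) with shortcut-or-back b→c c→d | shortcut-or-back c→d d→y
    ... | inj₁ b⇝d | _        = close-tail₂ (within-trans b⇝d (within-arc d→y))
    ... | inj₂ _   | inj₁ c⇝y = close-tail₂ (within-trans (within-arc b→c) c⇝y)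
    ... | inj₂ d→b | inj₂ y→c
        with near-or-forward d→b b→x (within-mono (n≤1+n 1) (within-arc d→y))
    ...   | inj₁ near = inj₁ near
    ...   | inj₂ d→x
          with near-or-forward c→d d→x (within-trans (within-arc c→d) (within-arc d→y))
    ...     | inj₁ near = inj₁ near
    ...     | inj₂ c→x  = near-or-forward y→c c→x (within-mono z≤n within-refl)
    close-tail₃ (_ ◅ _ ◅ _ ◅ _ ◅ _ , s≤s (s≤s (s≤s ())))

  -- Induction on the walk. Holding the first arc apart keeps the recursion structural: when an arc
  -- `c` replaces the first two, the rest `w` is a proper part of the old walk. Without a shortcut
  -- there is a triangle, and the claim for `w` finishes.
  near-or-back : ∀ {x y} → Walk D x y → Near x y ⊎ Arc y x
  near-or-back-via : ∀ {x a y} → Arc x a → Walk D a y → Near x y ⊎ Arc y x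

  near-or-back ε       = inj₁ (within-mono z≤n within-refl)
  near-or-back (a ◅ w) = near-or-back-via a w

  near-or-back-via a ε = inj₁ (within-mono (s≤s z≤n) (within-arc a))
  near-or-back-via a (b ◅ w) with shortcut-or-back a b
  ... | inj₁ (ε , _)              = near-or-back w
  ... | inj₁ (c ◅ ε , _)          = near-or-back-via c w
  ... | inj₁ (_ ◅ _ ◅ _ , s≤s ())
  ... | inj₂ c = [ close-tail₃ a b c , return a b c ]′ (near-or-back w)

  inNeighbour? : ∀ x → Unary.Decidable (λ y → Arc y x)
  inNeighbour? x y = arc? y x

  inNeighbours : Vertex D → Subset order
  inNeighbours x = comprehension (inNeighbour? x)

  indegree : Vertex D → ℕ
  indegree x = ∣ inNeighbours x ∣

  far⇒indegree< : ∀ {x y} → Walk D x y → ¬ Near x y → Arc y x × indegree y < indegree x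
  far⇒indegree< {x} {y} w far with near-or-back w
  ... | inj₁ near = contradiction near far
  ... | inj₂ y→x  = y→x , p⊂q⇒∣p∣<∣q∣ (inc , y , ∈-comprehension⁺ (inNeighbour? x) y→x , y∉)
    where
    -- `y` itself makes the inclusion proper: it is an in-neighbour of `x` but, without loops, not
    -- of `y`.
    y∉ = λ y∈ → loopless y (∈-comprehension⁻ (inNeighbour? y) y∈)

    inc : ∀ {z} → z ∈ inNeighbours y → z ∈ inNeighbours x
    inc {z} z∈ with ∈-comprehension⁻ (inNeighbour? y) z∈
    ... | z→y with shortcut-or-back z→y y→x
    ...   | inj₂ x→z = contradiction
            (within-mono (n≤1+n 2) (within-trans (within-arc x→z) (within-arc z→y))) far
    -- Here `z` is `x`, so `z→y` is an arc from `x` to `y`.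
    ...   | inj₁ (ε , _) = contradiction (within-mono (s≤s z≤n) (within-arc z→y)) far
    ...   | inj₁ (z→x ◅ ε , _) = ∈-comprehension⁺ (inNeighbour? x) z→x
    ...   | inj₁ (_ ◅ _ ◅ _ , s≤s ())

-- H-length and the kernel.

-- Obstructions sit only at internal vertices.
hLength≤ : (H D : Digraph) (ρ : Coloring D H) {u v : Vertex D} (w : Walk D u v) →
           hLength H D ρ w ≤ pred (length {D} w) + 1
hLength≤ H D ρ w = +-monoˡ-≤ 1 (∣p∣≤n (obstructions H D ρ w))

theorem16 : (H D : Digraph) → Loopless D → (ρ : Coloring D H) → QuasiTransitive D → (k : ℕ) → 4 ≤ k → Σ[ S ∈ Subset (Digraph.order D) ] IsKernel H D ρ k S
theorem16 H D loopless ρ qt k 4≤k = S , record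
  { independent = λ u∈S v∈S u≢v w _ →
      contradiction (maximal-unique (maximal u∈S) (maximal v∈S) w) u≢v
  ; absorbent = λ {x} _ →
      let s , w , max = maximal-above x
          v , v≤3     = near w max
          p , p! , p≤v = walk⇒path v
      in s , ∈-comprehension⁺ maximal? max , p , p! ,
         -- Three arcs leave two internal vertices, so the H-length is at most 2 + 1, and 3 ≤
         -- `k ∸ 1`.
         ≤-trans (hLength≤ H D ρ p)
           (≤-trans (+-monoˡ-≤ 1 (pred-mono-≤ (≤-trans p≤v v≤3))) (∸-monoˡ-≤ 1 4≤k))
  }
  where
  open Reachability D
  open QuasiTransitivity D loopless qt
  open Representatives ε _◅◅_ walk? indegree

  S = comprehension maximal?

  maximal : ∀ {x} → x ∈ S → Maximal x
  maximal = ∈-comprehension⁻ maximal?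

  near : ∀ {x s} → Walk D x s → Maximal s → Near x s
  -- Bounded distance is decidable, so refuting `far` is enough: it would make `s` reach a vertex of
  -- larger in-degree.
  near {x} {s} w max = decidable-stable (within? 3 x s) λ far →
    let s→x , s<x = far⇒indegree< w far in maximal-heaviest max (s→x ◅ ε) s<x
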